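{- Let $f \colon A^n \to B$, and assume that $n > |A|$ and $f$ is determined by $\operatorname{supp}$. Then the function $f$ is reconstructible.
   Context: $A$ and $B$ are sets with at least two elements; $n$ is a positive integer. $[n] := \{1,\dots,n\}$, $\binom{[n]}{2}$ denotes the set of all $2$-element subsets of $[n]$, and $\Sigma_n$ is the symmetric group on $[n]$. For $\mathbf{a} \in A^n$ and $\sigma \colon [m] \to [n]$, write $\mathbf{a}\sigma := (a_{\sigma(1)},\dots,a_{\sigma(m)}) \in A^m$. Functions $f, g \colon A^n \to B$ are equivalent, $f \equiv g$, if there is $\sigma \in \Sigma_n$ with $f(\mathbf{a}) = g(\mathbf{a}\sigma)$ for all $\mathbf{a} \in A^n$. For $n \geq 2$, $f \colon A^n \to B$ and $I \in \binom{[n]}{2}$, the identification minor $f_I \colon A^{n-1} \to B$ is given by $f_I(\mathbf{a}) = f(\mathbf{a}\delta_I)$, where $\delta_I \colon [n] \to [n-1]$ is defined by $\delta_I(i) = i$ if $i < \max I$, $\delta_I(i) = \min I$ if $i = \max I$, and $\delta_I(i) = i-1$ if $i > \max I$. The deck of $f$, $\operatorname{deck} f$, is the multiset $\{f_I/{\equiv} : I \in \binom{[n]}{2}\}$ of equivalence classes. A function $g \colon A^n \to B$ is a reconstruction of $f$ if $\operatorname{deck} f = \operatorname{deck} g$. The function $f$ is reconstructible if it is equivalent to all of its reconstructions. $\mathcal{P}(A)$ is the power set of $A$ and $\operatorname{supp}(a_1,\dots,a_n) := \{a_1,\dots,a_n\}$. A function $f \colon A^n \to B$ is determined by $\operatorname{supp}$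 if there exists $f^* \colon \mathcal{P}(A) \to B$ such that $f = f^* \circ \operatorname{supp}|_{A^n}$. -}

module Defs where

open import Level using (Level; _⊔_)
open import Data.Bool.Base using (Bool)
open import Data.Nat.Base using (ℕ; suc; s<s⁻¹)
import Data.Nat.Properties as ℕ
open import Data.Fin.Base using (Fin; zero; suc; lower; _<_)
open import Data.Fin.Properties using (<-cmp; inj⇒≟; toℕ≤pred[n])
open import Data.Fin.Permutation using (Permutation′; _⟨$⟩ʳ_)
open import Data.Product.Base using (Σ-syntax; ∃₂; _×_)
open import Data.Vec.Base using (Vec; lookup; tabulate)
import Data.Vec.Membership.DecPropositional as DecMembership
open import Function.Base using (_∘_)
open import Function.Bundles using (_↔_; Inverse)
open import Function.Properties.Inverse using (↔⇒↣)
open import Relation.Binary.Core using (_Preserves_⟶_)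
open import Relation.Binary.Definitions using (DecidableEquality; tri<; tri≈; tri>)
open import Relation.Binary.PropositionalEquality.Core using (_≡_; _≢_; _≗_)
open import Relation.Nullary.Decidable.Core using (does)

private
  variable
    a b : Level
    A : Set a
    B : Set b
    m n : ℕ

AtLeastTwo : Set a → Set a
AtLeastTwo A = ∃₂ λ (x y : A) → x ≢ y

infixl 20 _⊙_
_⊙_ : Vec A n → (Fin m → Fin n) → Vec A m
x ⊙ σ = tabulate (λ i → lookup x (σ i))

infix 4 _∼_
_∼_ : {A : Set a} {B : Set b} → (Vec A n → B) → (Vec A n → B) → Set (a ⊔ b)
_∼_ {n = n} f g = Σ[ σ ∈ Permutation′ n ] (∀ x → f x ≡ g (x ⊙ (σ ⟨$⟩ʳ_)))

-- A 2-element subset of a linearly ordered set is the same thing as a pair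
-- min < max; proofs of _<_ on Fin are unique, so nothing is counted twice.
record TwoSubset (n : ℕ) : Set where
  constructor twoSubset
  field
    min     : Fin n
    max     : Fin n
    min<max : min < max

-- Indices are counted from 0, which leaves the three clauses i ↦ i, i ↦ min I
-- and i ↦ i - 1 unchanged.  `lower` keeps the value of an index and only
-- changes its bound.
δ : TwoSubset (suc m) → Fin (suc m) → Fin m
δ {m} (twoSubset min max min<max) i with <-cmp i max
... | tri< i<max _ _ = lower i (ℕ.<-≤-trans i<max (toℕ≤pred[n] max))
... | tri≈ _ _ _     = lower min (ℕ.<-≤-trans min<max (toℕ≤pred[n] max))
δ (twoSubset _ _ _) (suc i) | tri> _ _ _ = i

minor : (Vec A (suc m) → B) → TwoSubset (suc m) → (Vec A m → B)
minor f I x = f (x ⊙ δ I)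

-- A multiset of ∼-classes is presented by a family of representatives.  Two
-- families over the same (finite) index set present the same multiset exactly
-- when some bijection of the index set matches them up to ∼.
Multiset : Set → Set a → Set b → ℕ → Set (a ⊔ b)
Multiset I A B n = I → (Vec A n → B)

infix 4 _≋_
_≋_ : {I : Set} {A : Set a} {B : Set b} →
      Multiset I A B n → Multiset I A B n → Set (a ⊔ b)
_≋_ {I = I} F G = Σ[ π ∈ I ↔ I ] (∀ i → F i ∼ G (Inverse.to π i))

deck : (Vec A (suc m) → B) → Multiset (TwoSubset (suc m)) A B m
deck = minor

IsReconstructionOf : {A : Set a} {B : Set b} →
                     (g f : Vec A (suc m) → B) → Set (a ⊔ b)
IsReconstructionOf g f = deck f ≋ deck g

Reconstructible : {A : Set a} {B : Set b} → (Vec A (suc m) → B) → Set (a ⊔ b)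
Reconstructible f = ∀ g → IsReconstructionOf g f → f ∼ g

-- The power set of a finite set, as characteristic functions.  Equality of
-- subsets is _≗_, hence maps out of 𝒫 A are required to respect _≗_.
𝒫 : Set a → Set a
𝒫 A = A → Bool

module _ {A : Set a} {k : ℕ} (enum : A ↔ Fin k) where

  private
    _≟_ : DecidableEquality A
    _≟_ = inj⇒≟ (↔⇒↣ enum)

  open DecMembership _≟_ using (_∈?_)

  supp : Vec A n → 𝒫 A
  supp x c = does (c ∈? x)

  DeterminedBySupp : {B : Set b} → (Vec A n → B) → Set (a ⊔ b)
  DeterminedBySupp {B = B} f =
    Σ[ f* ∈ (𝒫 A → B) ] (f* Preserves _≗_ ⟶ _≡_) × (f ≗ f* ∘ supp)

{-# OPTIONS --safe #-}
-- Since supp only sees the set of entries, all minors of f coincide with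
-- f* ∘ supp, hence so do all minors of a reconstruction g.  As n > |A|, every
-- y ∈ Aⁿ has two equal entries, so y = x δ_I for some I and x, and
-- g y = g_I x = f* (supp x) = f_I x = f y.  So even f ≗ g holds.
module Submission where

open import Defs
open import Level using (Level)
open import Data.Nat.Base using (ℕ; suc; _<_; s<s; s<s⁻¹)
import Data.Nat.Properties as ℕ
open import Data.Fin.Base as Fin using (Fin; zero; suc; toℕ; punchIn; lower)
open import Data.Fin.Permutation as Perm using (_⟨$⟩ʳ_; _⟨$⟩ˡ_)
open import Data.Fin.Properties
  using (_≟_; <-cmp; inj⇒≟; pigeonhole; punchIn-injective; punchInᵢ≢i)
open import Data.Product.Base using (∃₂; _,_; proj₁; proj₂)
open import Data.Vec.Base using (Vec; lookup)
open import Data.Vec.Membership.Propositional using (_∈_)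
open import Data.Vec.Membership.Propositional.Properties using (∈-lookup; ∈-tabulate⁺)
import Data.Vec.Membership.DecPropositional as DecMembership
open import Data.Vec.Properties
  using (lookup∘tabulate; tabulate∘lookup; tabulate-cong)
open import Data.Vec.Relation.Unary.Any using (index)
open import Data.Vec.Relation.Unary.Any.Properties using (lookup-index; tabulate⁻)
open import Function.Base using (id; _∘_)
open import Function.Bundles using (_↔_; _⇔_; mk⇔; Inverse; Injection)
open import Function.Definitions using (StrictlySurjective)
open import Function.Properties.Inverse using (↔⇒↣)
open import Relation.Binary.Core using (_Preserves_⟶_)
open import Relation.Binary.Definitions using (tri<; tri≈; tri>)
open import Relation.Binary.PropositionalEquality
  using (_≡_; _≢_; _≗_; refl; sym; trans; cong; subst; module ≡-Reasoning)
open import Relation.Nullary.Decidable using (yes; no; does-⇔)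
open import Relation.Nullary.Negation using (contradiction)

private
  variable
    a b : Level
    A : Set a
    B : Set b
    k l m n : ℕ

⊙-identity : (x : Vec A n) → x ⊙ id ≡ x
⊙-identity = tabulate∘lookup

⊙-assoc : (x : Vec A n) (σ : Fin m → Fin n) (τ : Fin l → Fin m) →
          x ⊙ σ ⊙ τ ≡ x ⊙ (σ ∘ τ)
⊙-assoc x σ τ = tabulate-cong (λ i → lookup∘tabulate _ (τ i))

⊙-cong : (x : Vec A n) {σ τ : Fin m → Fin n} → σ ≗ τ → x ⊙ σ ≡ x ⊙ τ
⊙-cong x σ≗τ = tabulate-cong (λ i → cong (lookup x) (σ≗τ i))

-- Surjectivity serves the direction from `x`: the position of `c` in `x` has a preimage under `τ`,
-- and `c` reappears there.
∈-⊙ : (x : Vec A n) {τ : Fin m → Fin n} → StrictlySurjective _≡_ τ →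
      ∀ {c} → c ∈ x ⊙ τ ⇔ c ∈ x
∈-⊙ x {τ} surj {c} = mk⇔ to from
  where
  to : c ∈ x ⊙ τ → c ∈ x
  to c∈ with i , refl ← tabulate⁻ c∈ = ∈-lookup (τ i) x

  from : c ∈ x → c ∈ x ⊙ τ
  from c∈ with i , τi≡ ← surj (index c∈) =
    subst (_∈ x ⊙ τ) (trans (cong (lookup x) τi≡) (sym (lookup-index c∈)))
      (∈-tabulate⁺ _ i)

permutation-surjective : (σ : Perm.Permutation m n) → StrictlySurjective _≡_ (σ ⟨$⟩ʳ_)
permutation-surjective σ i = σ ⟨$⟩ˡ i , Perm.inverseʳ σ

-- With `punchIn-suc`, this inverts the two clauses of `δ` away from `max`: `punchIn j` keeps what
-- lies below `j` and shifts the rest up past the gap at `j`.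
punchIn-lower : ∀ {i j : Fin (suc m)} .(i<m : toℕ i < m) → i Fin.< j →
                punchIn j (lower i i<m) ≡ i
punchIn-lower {suc _} {zero}  {suc _} _   _   = refl
punchIn-lower {suc _} {suc _} {suc _} i<m i<j =
  cong suc (punchIn-lower (s<s⁻¹ i<m) (s<s⁻¹ i<j))

punchIn-suc : ∀ {i : Fin m} {j : Fin (suc m)} → j Fin.< Fin.suc i → punchIn j i ≡ suc i
punchIn-suc {j = zero}              _         = refl
punchIn-suc {i = zero}  {j = suc _} (s<s ())
punchIn-suc {i = suc _} {j = suc _} j<i       = cong suc (punchIn-suc (s<s⁻¹ j<i))

module _ (I : TwoSubset (suc m)) where
  open TwoSubset I

  punchIn-δ : ∀ {i} → i ≢ max → punchIn max (δ I i) ≡ i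
  punchIn-δ {i} i≢max with <-cmp i max
  ... | tri< i<max _ _ = punchIn-lower _ i<max
  ... | tri≈ _ i≡max _ = contradiction i≡max i≢max
  -- No index `zero` lies above `max`, and exposing the successor lets `δ I` reduce.
  punchIn-δ {suc _} _ | tri> _ _ max<i = punchIn-suc max<i

  punchIn-δ-max : punchIn max (δ I max) ≡ min
  punchIn-δ-max with <-cmp max max
  ... | tri< max<max _ _ = contradiction max<max (ℕ.<-irrefl refl)
  ... | tri≈ _ _ _       = punchIn-lower _ min<max
  ... | tri> _ _ max<max = contradiction max<max (ℕ.<-irrefl refl)

  -- `punchIn max` is a section of `δ I`: its values avoid `max`, so `punchIn-δ` applies to them,
  -- and injectivity cancels the outer `punchIn max`.
  δ-surjective : StrictlySurjective _≡_ (δ I)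
  δ-surjective i =
    punchIn max i , punchIn-injective max _ _ (punchIn-δ (punchInᵢ≢i max i))

  -- `punchIn max` deletes the entry at `max`, and `δ I` refills that place with a copy of the entry
  -- at `min`, which is the deleted value.
  ⊙-punchIn-δ : (x : Vec A (suc m)) → lookup x min ≡ lookup x max →
                x ⊙ punchIn max ⊙ δ I ≡ x
  ⊙-punchIn-δ x xmin≡xmax = begin
    x ⊙ punchIn max ⊙ δ I       ≡⟨ ⊙-assoc x (punchIn max) (δ I) ⟩
    x ⊙ (punchIn max ∘ δ I)     ≡⟨ tabulate-cong entry ⟩
    x ⊙ id                      ≡⟨ ⊙-identity x ⟩
    x                           ∎
    where
    open ≡-Reasoning
    entry : ∀ i → lookup x (punchIn max (δ I i)) ≡ lookup x i
    entry i with i ≟ max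
    ... | yes refl  = trans (cong (lookup x) punchIn-δ-max) xmin≡xmax
    ... | no  i≢max = cong (lookup x) (punchIn-δ i≢max)

module _ {A : Set a} (enum : A ↔ Fin k) where

  open DecMembership (inj⇒≟ (↔⇒↣ enum)) using (_∈?_)

  -- This covers both reindexings that occur: `δ I` in passing to a minor, and permutations in
  -- passing along `∼`.
  supp-⊙ : (x : Vec A n) {τ : Fin m → Fin n} → StrictlySurjective _≡_ τ →
           supp enum (x ⊙ τ) ≗ supp enum x
  supp-⊙ x {τ} surj c = does-⇔ (∈-⊙ x surj) (c ∈? x ⊙ τ) (c ∈? x)

  ∃-⊙-δ : k < suc m → (y : Vec A (suc m)) → ∃₂ λ I x → x ⊙ δ I ≡ y
  -- The entries are compared by their codes in `Fin k`; injectivity of `enum` carries the collision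
  -- back to `A`.
  ∃-⊙-δ k<n y with i , j , i<j , eq ← pigeonhole k<n (Inverse.to enum ∘ lookup y) =
    twoSubset i j i<j , y ⊙ punchIn j ,
    ⊙-punchIn-δ (twoSubset i j i<j) y (Injection.injective (↔⇒↣ enum) eq)

  module _ {B : Set b} {f : Vec A (suc m) → B} {f* : 𝒫 A → B}
           (f*-cong : f* Preserves _≗_ ⟶ _≡_) (f≗ : f ≗ f* ∘ supp enum) where

    minor-determined : ∀ I → minor f I ≗ f* ∘ supp enum
    minor-determined I x = trans (f≗ (x ⊙ δ I)) (f*-cong (supp-⊙ x (δ-surjective I)))

    -- As `π` is onto, every card of `g` is matched with some card of `f`. The latter depends on the
    -- support alone, so the permutation in the match cannot change its values.
    reconstruction-minor : ∀ g → IsReconstructionOf g f →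
                           ∀ I → minor g I ≗ f* ∘ supp enum
    reconstruction-minor g (π , matches) I x = begin
      minor g I x                ≡⟨ cong (minor g I) x≡ ⟨
      minor g I (z ⊙ (σ ⟨$⟩ʳ_))
        ≡⟨ cong (λ J → minor g J (z ⊙ (σ ⟨$⟩ʳ_))) (Inverse.strictlyInverseˡ π I) ⟨
      minor g (Inverse.to π I′) (z ⊙ (σ ⟨$⟩ʳ_))
                                 ≡⟨ proj₂ (matches I′) z ⟨
      minor f I′ z               ≡⟨ minor-determined I′ z ⟩
      f* (supp enum z)           ≡⟨ f*-cong (supp-⊙ x (permutation-surjective (Perm.flip σ))) ⟩
      f* (supp enum x)           ∎
      where
      open ≡-Reasoning
      I′ = Inverse.from π I
      σ = proj₁ (matches I′)
      -- The match evaluates the card of `g` at `z ⊙ σ`; applying the inverse permutation first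
      -- makes that vector equal to `x`.
      z = x ⊙ (σ ⟨$⟩ˡ_)
      x≡ : z ⊙ (σ ⟨$⟩ʳ_) ≡ x
      x≡ = begin
        z ⊙ (σ ⟨$⟩ʳ_)                     ≡⟨ ⊙-assoc x (σ ⟨$⟩ˡ_) (σ ⟨$⟩ʳ_) ⟩
        x ⊙ (λ i → σ ⟨$⟩ˡ (σ ⟨$⟩ʳ i))     ≡⟨ ⊙-cong x (λ _ → Perm.inverseˡ σ) ⟩
        x ⊙ id                            ≡⟨ ⊙-identity x ⟩
        x                                 ∎

    reconstruction-≗ : k < suc m → ∀ g → IsReconstructionOf g f → f ≗ g
    -- Once `y` is replaced by `x ⊙ δ I`, both sides are by definition values of minors at `x`.
    reconstruction-≗ k<n g rec y with I , x , refl ← ∃-⊙-δ k<n y =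
      trans (minor-determined I x) (sym (reconstruction-minor g rec I x))

proposition3p10 : ∀ {a b : Level} {A : Set a} {B : Set b} →
    AtLeastTwo A → AtLeastTwo B →
    (k : ℕ) (|A|≡k : A ↔ Fin k) →
    (m : ℕ) → let n = suc m in
    k < n →
    (f : Vec A n → B) →
    DeterminedBySupp |A|≡k f →
    Reconstructible f
proposition3p10 _ _ k |A|≡k m k<n f (f* , f*-cong , f≗) g rec =
  Perm.id , λ x → trans (reconstruction-≗ |A|≡k f*-cong f≗ k<n g rec x) (cong g (sym (⊙-identity x)))
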